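{- Every graph with treewidth $k$ admits a $(k+1)$-local queue layout.
   Context: Graphs are finite, simple and undirected. Given a linear ordering $\prec$ of the vertex set of a graph, two edges $uv$ and $xy$ nest if $u \prec x \prec y \prec v$ or $x \prec u \prec v \prec y$ (for the endpoints named suitably). A queue is a set of edges no two of which nest. A queue layout of $G$ consists of a linear ordering $\prec$ of $V(G)$ and a partition of $E(G)$ into queues; it is $\ell$-local if every vertex has incident edges in at most $\ell$ queues (the total number of queues being arbitrary). -}

module Defs where

open import Data.Bool.Base using (Bool; T)
open import Data.Bool.Properties using (T?; T-irrelevant)
open import Data.Fin.Base using (Fin)
open import Data.Fin.Properties using (any?; _≟_)
open import Data.Fin.Subset using (Subset; _∈_; ∣_∣)
open import Data.List.Base using (List; _∷_; _∷ʳ_; length; map; filter; allFin)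
open import Data.List.Extrema.Nat using (max)
open import Data.List.Relation.Unary.Linked using (Linked)
open import Data.List.Relation.Unary.Unique.Propositional using (Unique)
open import Data.Nat.Base using (ℕ; _∸_; _≤_)
open import Data.Product.Base using (Σ; ∃; _×_; _,_)
open import Data.Sum.Base using (_⊎_)
open import Level using (0ℓ)
open import Relation.Binary.Core using (Rel)
open import Relation.Binary.Construct.Closure.ReflexiveTransitive using (Star)
open import Relation.Binary.Definitions using (Symmetric; Irreflexive)
open import Relation.Binary.PropositionalEquality using (_≡_; trans; cong)
open import Relation.Binary.Structures using (IsStrictTotalOrder)
open import Relation.Nullary using (¬_; Dec; yes; no)
open import Relation.Unary using (Decidable)

-- Adjacency is Boolean-valued so that it is decidable and an edge between two
-- given vertices is unique (T b is a proposition).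
record Graph : Set where
  field
    order : ℕ

  Vertex : Set
  Vertex = Fin order

  field
    adj : Vertex → Vertex → Bool

  _∼_ : Rel Vertex 0ℓ
  u ∼ v = T (adj u v)

  field
    ∼-sym     : Symmetric _∼_
    ∼-irrefl  : Irreflexive _≡_ _∼_

module _ (G : Graph) where
  open Graph G

  Connected : Set
  Connected = ∀ u v → Star _∼_ u v

  -- A cycle x, v₁, …, vₘ, x: distinct vertices, m ≥ 2.
  IsCycle : Vertex → List Vertex → Set
  IsCycle x vs = 2 ≤ length vs × Unique (x ∷ vs) × Linked _∼_ (x ∷ (vs ∷ʳ x))

  Acyclic : Set
  Acyclic = ∀ x vs → ¬ IsCycle x vs

  record IsTree : Set where
    field
      root      : Vertex  -- trees are nonempty; the choice of vertex is immaterial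
      connected : Connected
      acyclic   : Acyclic

record TreeDecomposition (G : Graph) : Set where
  open Graph G using (order; Vertex; _∼_)
  field
    tree   : Graph
    isTree : IsTree tree

  open Graph tree public using () renaming (order to nodes; Vertex to Node; _∼_ to _∼ᵗ_)

  field
    bag : Node → Subset order

  -- Tree edges inside the subgraph induced by the nodes whose bags contain v.
  Within : Vertex → Rel Node 0ℓ
  Within v s t = s ∼ᵗ t × v ∈ bag s × v ∈ bag t

  field
    vertex-covered : ∀ v → ∃ λ t → v ∈ bag t
    edge-covered   : ∀ {u v} → u ∼ v → ∃ λ t → u ∈ bag t × v ∈ bag t
    bags-connected : ∀ v {s t} → v ∈ bag s → v ∈ bag t → Star (Within v) s t

  -- Truncated subtraction only matters for the graph with no vertices, whose
  -- treewidth is thereby 0 rather than -1.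
  width : ℕ
  width = max 0 (map (λ t → ∣ bag t ∣) (allFin nodes)) ∸ 1

open TreeDecomposition using (width)

HasTreewidth : Graph → ℕ → Set
HasTreewidth G k =
  (∃ λ (D : TreeDecomposition G) → width D ≡ k) ×
  (∀ (D : TreeDecomposition G) → k ≤ width D)

Nest : {V : Set} → Rel V 0ℓ → (u v x y : V) → Set
Nest _≺_ u v x y = (u ≺ x × x ≺ y × y ≺ v) ⊎ (x ≺ u × u ≺ v × v ≺ y)

-- The partition of the edges is given by its class map.  An undirected edge is
-- seen as both u ∼ v and v ∼ u, hence queue-sym; quantifying no-nest over all
-- u, v, x, y accounts for every naming of the endpoints.  Classes may be empty,
-- which affects neither nesting nor locality.
record QueueLayout (G : Graph) : Set₁ where
  open Graph G
  field
    _≺_                : Rel Vertex 0ℓ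
    isStrictTotalOrder : IsStrictTotalOrder _≡_ _≺_
    queues             : ℕ
    queue              : ∀ {u v} → u ∼ v → Fin queues
    queue-sym          : ∀ {u v} (e : u ∼ v) → queue (∼-sym e) ≡ queue e
    no-nest            : ∀ {u v x y} (e : u ∼ v) (f : x ∼ y) →
                         queue e ≡ queue f → ¬ Nest _≺_ u v x y

  IncidentTo : Vertex → Fin queues → Set
  IncidentTo v i = ∃ λ u → Σ (v ∼ u) λ e → queue e ≡ i

  incidentTo? : ∀ v → Decidable (IncidentTo v)
  incidentTo? v i = any? via?
    where
    via? : ∀ u → Dec (Σ (v ∼ u) λ e → queue e ≡ i)
    via? u with T? (adj v u)
    ... | no  v≁u = no λ (e , _) → v≁u e
    ... | yes e with queue e ≟ i
    ...   | yes q≡i = yes (e , q≡i)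
    ...   | no  q≢i = no λ (e′ , q≡i) → q≢i (trans (cong queue (T-irrelevant e e′)) q≡i)

  queuesAt : Vertex → ℕ
  queuesAt v = length (filter (incidentTo? v) (allFin queues))

  IsLocal : ℕ → Set
  IsLocal ℓ = ∀ v → queuesAt v ≤ ℓ

{-# OPTIONS --safe #-}
-- Root the decomposition tree and let top v be the node closest to the root
-- whose bag contains v.  Assign every edge uv to the endpoint whose top is closer
-- to the root.  The classes are stars, and two edges with a common endpoint never
-- nest, so any vertex ordering works.  If uv is assigned to u then top v lies on
-- the tree path from a common bag of u and v to top u, hence u ∈ bag (top v).
-- Thus the queues at v are indexed by elements of bag (top v), of size at most k + 1.
module Submission where

open import Data.Bool.Properties using (T?)
open import Data.Fin.Base using (Fin; zero; suc)
import Data.Fin.Base as Fin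
open import Data.Fin.Properties using (any?; _≟_)
import Data.Fin.Properties as Fin
open import Data.Fin.Subset using (Subset; _∈_; ∣_∣; inside; outside)
open import Data.Fin.Subset.Properties using (_∈?_; drop-there)
open import Data.List.Base using (List; []; _∷_; _∷ʳ_; length; map; filter; allFin; tabulate)
open import Data.List.Extrema.Nat using (xs≤max)
import Data.List.Membership.DecPropositional as DecMembership
open import Data.List.Membership.Propositional using () renaming (_∈_ to _∈ˡ_; _∉_ to _∉ˡ_)
open import Data.List.Membership.Propositional.Properties using (∈-allFin; ∈-map⁺)
open import Data.List.Relation.Unary.All using ([]; lookup)
open import Data.List.Relation.Unary.All.Properties using (¬Any⇒All¬)
open import Data.List.Relation.Unary.AllPairs using ([]; _∷_)
open import Data.List.Relation.Unary.Any using (here; there)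
open import Data.List.Relation.Unary.Linked using (Linked; [-]; _∷_)
open import Data.List.Relation.Unary.Unique.Propositional using (Unique)
open import Data.Nat.Base using (ℕ; zero; suc; _+_; _≤_; _<_; z≤n; s≤s)
open import Data.Nat.Induction using (<-wellFounded)
open import Data.Nat.Properties using
  (≤-refl; ≤-reflexive; ≤-trans; <⇒≤; <⇒≱; <-irrefl; <-trans; <-≤-trans; ≤-<-trans; <-cmp;
   m≤n⇒m≤1+n; m≤n+m∸n; +-comm; module ≤-Reasoning)
import Data.Nat.Properties as ℕ
open import Data.Product.Base using (∃; _×_; _,_; proj₁; proj₂; swap)
open import Data.Sum.Base using (_⊎_; inj₁; inj₂)
import Data.Sum.Base as Sum
import Data.Vec.Base as Vec
open import Function.Base using (_∘_)
open import Induction.WellFounded using (Acc; acc)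
open import Level using (0ℓ)
open import Relation.Binary.Construct.Closure.ReflexiveTransitive using (Star; ε; _◅_; _◅◅_; reverse)
import Relation.Binary.Construct.Closure.ReflexiveTransitive as Star
open import Relation.Binary.Core using (Rel; _⇒_)
open import Relation.Binary.Definitions using (Symmetric; DecidableEquality; tri<; tri≈; tri>)
open import Relation.Binary.PropositionalEquality using (_≡_; _≢_; refl; sym; trans; subst)
open import Relation.Nullary using (¬_; yes; no; contradiction; _×-dec_)
open import Relation.Unary using (Pred; Decidable)
open import Defs

-- Least witnesses and counting.

Least : Pred ℕ 0ℓ → Set
Least P = ∃ λ n → P n × (∀ {m} → P m → n ≤ m)

least : ∀ {P : Pred ℕ 0ℓ} → Decidable P → ∀ n → P n → Least P
least P? zero p = 0 , p , λ _ → z≤n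
least {P} P? (suc n) p with P? 0
... | yes p₀ = 0 , p₀ , λ _ → z≤n
... | no ¬p₀ with least (P? ∘ suc) n p
...   | m , q , m-least = suc m , q , bound
  where
  bound : ∀ {i} → P i → suc m ≤ i
  bound {zero}  p₀ = contradiction p₀ ¬p₀
  bound {suc i} q  = s≤s (m-least q)

-- An arbitrary `f` is allowed because the induction passes from `f` to `f ∘ suc`; `allFin` is the
-- case of the identity.
length-filter-tabulate≤∣∣ :
  ∀ {A : Set} {P : Pred A 0ℓ} (P? : Decidable P) {n} (f : Fin n → A) (S : Subset n) →
  (∀ {i} → P (f i) → i ∈ S) → length (filter P? (tabulate f)) ≤ ∣ S ∣
length-filter-tabulate≤∣∣ P? {zero}  f Vec.[]      P⊆S = z≤n
length-filter-tabulate≤∣∣ P? {suc n} f (b Vec.∷ S) P⊆S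
  with rest ← length-filter-tabulate≤∣∣ P? (f ∘ suc) S (drop-there ∘ P⊆S)
  with P? (f zero)
length-filter-tabulate≤∣∣ P? {suc n} f (inside  Vec.∷ S) P⊆S | no  _ = m≤n⇒m≤1+n rest
length-filter-tabulate≤∣∣ P? {suc n} f (outside Vec.∷ S) P⊆S | no  _ = rest
length-filter-tabulate≤∣∣ P? {suc n} f (inside  Vec.∷ S) P⊆S | yes _ = s≤s rest
length-filter-tabulate≤∣∣ P? {suc n} f (outside Vec.∷ S) P⊆S | yes p with () ← P⊆S p

-- Simple paths and loop erasure.

module _ {A : Set} (R : Rel A 0ℓ) where

  -- The list holds the vertices after the start, the format in which `IsCycle` takes a cycle.
  data SimplePath : A → A → List A → Set where
    []   : ∀ {x} → SimplePath x x []
    step : ∀ {x y z vs} → R x y → x ∉ˡ y ∷ vs → SimplePath y z vs → SimplePath x z (y ∷ vs)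

module _ {A : Set} {R : Rel A 0ℓ} where

  cut : ∀ {x y z vs} → SimplePath R y z vs → x ∈ˡ y ∷ vs → ∃ (SimplePath R x z)
  cut p            (here refl) = _ , p
  cut (step _ _ p) (there x∈)  = cut p x∈

  loopErase : DecidableEquality A → ∀ {x y} → Star R x y → ∃ (SimplePath R x y)
  loopErase _≟ᴬ_ ε = [] , []
  loopErase _≟ᴬ_ {x} (_◅_ {j = y} r w) with loopErase _≟ᴬ_ w
  ... | vs , p with DecMembership._∈?_ _≟ᴬ_ x (y ∷ vs)
  ...   | yes x∈ = cut p x∈
  ...   | no  x∉ = y ∷ vs , step r x∉ p

  simplePath-unique : ∀ {x y vs} → SimplePath R x y vs → Unique (x ∷ vs)
  simplePath-unique []            = [] ∷ []
  simplePath-unique (step _ x∉ p) = ¬Any⇒All¬ _ x∉ ∷ simplePath-unique p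

  -- Two relations are needed to close a cycle: the path avoids an edge, and that edge closes it.
  simplePath-linked : ∀ {S : Rel A 0ℓ} → R ⇒ S → ∀ {x y z vs} →
                      SimplePath R x y vs → S y z → Linked S (x ∷ (vs ∷ʳ z))
  simplePath-linked R⇒S []           s = s ∷ [-]
  simplePath-linked R⇒S (step r _ p) s = R⇒S r ∷ simplePath-linked R⇒S p s

-- Edges of acyclic graphs are bridges.

module Bridges (G : Graph) (acyclic : Acyclic G) where
  open Graph G

  Avoiding : Vertex → Vertex → Rel Vertex 0ℓ
  Avoiding a b x y = x ∼ y × ¬ (x ≡ a × y ≡ b) × ¬ (x ≡ b × y ≡ a)

  avoiding-sym : ∀ {a b} → Symmetric (Avoiding a b)
  avoiding-sym (e , ≢ab , ≢ba) = ∼-sym e , ≢ba ∘ swap , ≢ab ∘ swap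

  avoiding-flip : ∀ {a b} → Avoiding a b ⇒ Avoiding b a
  avoiding-flip (e , ≢ab , ≢ba) = e , ≢ba , ≢ab

  -- After loop erasure, a path of length 0 would make `a∼b` a loop, one of length 1 would be the
  -- avoided edge, and a longer one closes up to a cycle through `a∼b`.
  bridge : ∀ {a b} → a ∼ b → ¬ Star (Avoiding a b) a b
  bridge {a} {b} a∼b w with loopErase _≟_ w
  ... | []         , []                        = ∼-irrefl refl a∼b
  ... | _ ∷ []     , step (_ , ≢ab , _) _ []   = ≢ab (refl , refl)
  ... | vs@(_ ∷ _ ∷ _) , p =
    acyclic a vs (s≤s (s≤s z≤n) , simplePath-unique p , simplePath-linked proj₁ p (∼-sym a∼b))

-- Depth and parents in a rooted tree.

module RootedTree (G : Graph) (isTree : IsTree G) where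
  open Graph G
  open IsTree isTree
  open Bridges G acyclic

  -- Walks to the root of length exactly `n`: decidable by recursion on `n`, and the least `n` is
  -- the distance to the root.
  Reaches : Vertex → Pred ℕ 0ℓ
  Reaches t zero    = t ≡ root
  Reaches t (suc n) = ∃ λ s → t ∼ s × Reaches s n

  reaches? : ∀ t → Decidable (Reaches t)
  reaches? t zero    = t ≟ root
  reaches? t (suc n) = any? λ s → T? (adj t s) ×-dec reaches? s n

  reaches : ∀ {t} → Star _∼_ t root → ∃ (Reaches t)
  reaches ε       = 0 , refl
  reaches (e ◅ w) = let n , r = reaches w in suc n , _ , e , r

  leastReach : ∀ t → Least (Reaches t)
  leastReach t = let n , r = reaches (connected t root) in least (reaches? t) n r

  depth : Vertex → ℕ
  depth t = proj₁ (leastReach t)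

  _⇣_ : Rel Vertex 0ℓ
  t ⇣ s = t ∼ s × depth s < depth t

  parent : ∀ t → t ≡ root ⊎ ∃ (t ⇣_)
  parent t with leastReach t
  ... | zero  , t≡root      , _ = inj₁ t≡root
  -- The rest `r` of a shortest walk bounds the depth of its second vertex `s` by `n`.
  ... | suc n , (s , e , r) , _ = inj₂ (s , e , s≤s (proj₂ (proj₂ (leastReach s)) r))

  descend : ∀ t → Acc _<_ (depth t) → Star _⇣_ t root
  descend t (acc rec) with parent t
  ... | inj₁ refl    = ε
  ... | inj₂ (s , d) = d ◅ descend s (rec (proj₂ d))

  -- The start differs from `t` by hypothesis and all later vertices are strictly closer to the root
  -- than `t`, so the walk never meets `t`, an end of the avoided edge.
  avoid-higher : ∀ {s t x y} → x ≢ t → depth x ≤ depth t → Star _⇣_ x y → Star (Avoiding s t) x y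
  avoid-higher x≢t x≤t ε = ε
  avoid-higher x≢t x≤t ((e , y<x) ◅ w) =
    let y<t = <-≤-trans y<x x≤t
        y≢t = λ { refl → <-irrefl refl y<t }
    in (e , y≢t ∘ proj₂ , x≢t ∘ proj₁) ◅ avoid-higher y≢t (<⇒≤ y<t) w

  toRoot : ∀ {s t x} → x ≢ t → depth x ≤ depth t → Star (Avoiding s t) x root
  toRoot x≢t x≤t = avoid-higher x≢t x≤t (descend _ (<-wellFounded _))

  -- Descending walks to the root from the ends of an edge on one level, or from
  -- two distinct parents of t, would close up to a walk bypassing a bridge.
  ∼⇒depth≢ : ∀ {s t} → s ∼ t → depth s ≢ depth t
  ∼⇒depth≢ s∼t eq = bridge s∼t
    (toRoot (λ s≡t → ∼-irrefl s≡t s∼t) (≤-reflexive eq) ◅◅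
     reverse avoiding-sym
       (Star.map avoiding-flip (toRoot (λ t≡s → ∼-irrefl (sym t≡s) s∼t) (≤-reflexive (sym eq)))))

  parent-unique : ∀ {t s s′} → t ⇣ s → t ⇣ s′ → s ≡ s′
  parent-unique {t} {s} {s′} (t∼s , s<t) (t∼s′ , s′<t) with s ≟ s′
  ... | yes s≡s′ = s≡s′
  ... | no  s≢s′ = contradiction
    (toRoot (below s<t) (<⇒≤ s<t) ◅◅
     reverse avoiding-sym (toRoot (below s′<t) (<⇒≤ s′<t)) ◅◅
     (∼-sym t∼s′ , s≢s′ ∘ sym ∘ proj₁ , below s′<t ∘ proj₁) ◅ ε)
    (bridge (∼-sym t∼s))
    where
    below : ∀ {x} → depth x < depth t → x ≢ t
    below x<t refl = <-irrefl refl x<t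

  _⇣*_ : Rel Vertex 0ℓ
  _⇣*_ = Star _⇣_

  ⇣*⇒depth≥ : ∀ {t s} → t ⇣* s → depth s ≤ depth t
  ⇣*⇒depth≥ ε             = ≤-refl
  ⇣*⇒depth≥ ((_ , d) ◅ w) = ≤-trans (⇣*⇒depth≥ w) (<⇒≤ d)

  ⇣*-antisym-depth : ∀ {t s} → t ⇣* s → depth t ≤ depth s → t ≡ s
  ⇣*-antisym-depth ε             _   = refl
  ⇣*-antisym-depth ((_ , d) ◅ w) t≤s = contradiction t≤s (<⇒≱ (≤-<-trans (⇣*⇒depth≥ w) d))

  -- One of `a`, `b` is the parent of the other. A step to a child prolongs the descent; a step to
  -- the parent follows the descent from `a`, unless that is empty. So the subtree below `m` can
  -- only be left at `m`.
  ⇣*-cross : ∀ {a b m} → a ∼ b → a ⇣* m → b ⇣* m ⊎ (a ≡ m × depth b < depth a)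
  ⇣*-cross {a} {b} a∼b a⇣*m with <-cmp (depth a) (depth b)
  ... | tri< a<b _ _ = inj₁ ((∼-sym a∼b , a<b) ◅ a⇣*m)
  ... | tri≈ _ a≡b _ = contradiction a≡b (∼⇒depth≢ a∼b)
  ... | tri> _ _ b<a with a⇣*m
  ...   | ε     = inj₂ (refl , b<a)
  ...   | d ◅ w = inj₁ (subst (_⇣* _) (parent-unique d (a∼b , b<a)) w)

-- Topmost bags of a tree decomposition.

module Tops {G : Graph} (D : TreeDecomposition G) where
  open Graph G
  open TreeDecomposition D
  open RootedTree tree isTree

  IsHeight : Vertex → Pred ℕ 0ℓ
  IsHeight v n = ∃ λ t → v ∈ bag t × depth t ≡ n

  leastHeight : ∀ v → Least (IsHeight v)
  leastHeight v =
    least (λ n → any? λ t → (v ∈? bag t) ×-dec (depth t ℕ.≟ n))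
          _ (let t , v∈t = vertex-covered v in t , v∈t , refl)

  top : Vertex → Node
  top v = proj₁ (proj₁ (proj₂ (leastHeight v)))

  top-∈ : ∀ v → v ∈ bag (top v)
  top-∈ v = proj₁ (proj₂ (proj₁ (proj₂ (leastHeight v))))

  top-least : ∀ {v t} → v ∈ bag t → depth (top v) ≤ depth t
  top-least {v} v∈t with leastHeight v
  ... | _ , (_ , _ , refl) , n-least = n-least (_ , v∈t , refl)

  -- Leaving the subtree below `top v` would lead to a bag containing `v` closer to the root than
  -- `top v`.
  ⇣*-top-step : ∀ {v s t} → Star (Within v) s t → s ⇣* top v → t ⇣* top v
  ⇣*-top-step ε s⇣* = s⇣*
  ⇣*-top-step ((e , _ , v∈) ◅ w) s⇣* with ⇣*-cross e s⇣*
  ... | inj₁ b⇣*         = ⇣*-top-step w b⇣*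
  ... | inj₂ (refl , b<) = contradiction (top-least v∈) (<⇒≱ b<)

  ⇣*-top : ∀ {v t} → v ∈ bag t → t ⇣* top v
  ⇣*-top {v} v∈t = ⇣*-top-step (bags-connected v (top-∈ v) v∈t) ε

  -- The walk starts below `m` and ends no deeper than `m`, so it either leaves the subtree of `m`,
  -- which happens at `m`, or ends at `m` itself.
  through : ∀ {u s t m} → Star (Within u) s t → u ∈ bag s → s ⇣* m → depth t ≤ depth m → u ∈ bag m
  through ε                  u∈s s⇣* t≤m = subst (λ t → _ ∈ bag t) (⇣*-antisym-depth s⇣* t≤m) u∈s
  through ((e , _ , u∈) ◅ w) u∈s s⇣* t≤m with ⇣*-cross e s⇣*
  ... | inj₁ b⇣*        = through w u∈ b⇣* t≤m
  ... | inj₂ (refl , _) = u∈s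

  height : Vertex → ℕ
  height v = depth (top v)

  higher-∈-top : ∀ {u v} → u ∼ v → height u ≤ height v → u ∈ bag (top v)
  higher-∈-top {u} u∼v u≤v =
    let _ , u∈t , v∈t = edge-covered u∼v
    in through (bags-connected u u∈t (top-∈ u)) u∈t (⇣*-top v∈t) u≤v

  ∣bag∣≤1+width : ∀ t → ∣ bag t ∣ ≤ 1 + width
  ∣bag∣≤1+width t = ≤-trans
    (lookup (xs≤max 0 (map (λ t → ∣ bag t ∣) (allFin nodes))) (∈-map⁺ _ (∈-allFin t)))
    -- This bound survives truncation, so a maximum of 0 needs no separate case.
    (m≤n+m∸n _ 1)

-- Queue layouts whose queues are stars.

module StarLayout (G : Graph)
  (centre : Graph.Vertex G → Graph.Vertex G → Graph.Vertex G)
  (centre-comm : ∀ u v → centre u v ≡ centre v u)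
  (centre-sel : ∀ u v → centre u v ≡ u ⊎ centre u v ≡ v)
  where
  open Graph G

  private
    -- Edges with the same centre share an endpoint, whereas the four endpoints of nesting edges are
    -- distinct.
    apart : ∀ {u v x y} → centre u v ≡ centre x y →
            u ≢ x → u ≢ y → v ≢ x → v ≢ y → ∀ {A : Set} → A
    apart {u} {v} {x} {y} eq u≢x u≢y v≢x v≢y with centre-sel u v | centre-sel x y
    ... | inj₁ p | inj₁ q = contradiction (trans (sym p) (trans eq q)) u≢x
    ... | inj₁ p | inj₂ q = contradiction (trans (sym p) (trans eq q)) u≢y
    ... | inj₂ p | inj₁ q = contradiction (trans (sym p) (trans eq q)) v≢x
    ... | inj₂ p | inj₂ q = contradiction (trans (sym p) (trans eq q)) v≢y

    no-nest : ∀ {u v x y} → centre u v ≡ centre x y → ¬ Nest Fin._<_ u v x y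
    no-nest eq (inj₁ (u<x , x<y , y<v)) = apart eq
      (Fin.<⇒≢ u<x) (Fin.<⇒≢ (<-trans u<x x<y)) (Fin.<⇒≢ (<-trans x<y y<v) ∘ sym) (Fin.<⇒≢ y<v ∘ sym)
    no-nest eq (inj₂ (x<u , u<v , v<y)) = apart eq
      (Fin.<⇒≢ x<u ∘ sym) (Fin.<⇒≢ (<-trans u<v v<y)) (Fin.<⇒≢ (<-trans x<u u<v) ∘ sym) (Fin.<⇒≢ v<y)

  layout : QueueLayout G
  layout = record
    { _≺_                = Fin._<_
    ; isStrictTotalOrder = Fin.<-isStrictTotalOrder
    -- Queues are named by their centres, so a set of queues is a set of vertices and can be
    -- compared with a bag.
    ; queues             = order
    ; queue              = λ {u} {v} _ → centre u v
    ; queue-sym          = λ {u} {v} _ → centre-comm v u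
    ; no-nest            = λ _ _ → no-nest
    }

  queuesAt≤∣∣ : ∀ {v} (S : Subset order) → (∀ {u} → v ∼ u → centre v u ∈ S) →
                QueueLayout.queuesAt layout v ≤ ∣ S ∣
  queuesAt≤∣∣ {v} S centre∈S =
    length-filter-tabulate≤∣∣ (QueueLayout.incidentTo? layout v) _ S
      λ { (_ , e , refl) → centre∈S e }

-- Symmetric choice of an endpoint.

module Lower {n} (f : Fin n → ℕ) where
  open import Algebra.Construct.NaturalChoice.Min (Fin.≤-totalOrder n) using (_⊓_; ⊓-sel; ⊓-comm)

  -- Ties are broken by the order of `Fin n`, because the queue of an edge must not depend on its
  -- orientation.
  lower : Fin n → Fin n → Fin n
  lower u v with <-cmp (f u) (f v)
  ... | tri< _ _ _ = u
  ... | tri≈ _ _ _ = u ⊓ v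
  ... | tri> _ _ _ = v

  lower-sel : ∀ u v → (lower u v ≡ u × f u ≤ f v) ⊎ (lower u v ≡ v × f v ≤ f u)
  lower-sel u v with <-cmp (f u) (f v)
  ... | tri< u<v _ _ = inj₁ (refl , <⇒≤ u<v)
  ... | tri≈ _ u≡v _ = Sum.map (_, ≤-reflexive u≡v) (_, ≤-reflexive (sym u≡v)) (⊓-sel u v)
  ... | tri> _ _ v<u = inj₂ (refl , <⇒≤ v<u)

  lower-comm : ∀ u v → lower u v ≡ lower v u
  lower-comm u v with <-cmp (f u) (f v) | <-cmp (f v) (f u)
  ... | tri< _ _ _   | tri> _ _ _   = refl
  ... | tri≈ _ _ _   | tri≈ _ _ _   = ⊓-comm u v
  ... | tri> _ _ _   | tri< _ _ _   = refl
  ... | tri< _ _ v≮u | tri< v<u _ _ = contradiction v<u v≮u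
  ... | tri< _ u≢v _ | tri≈ _ v≡u _ = contradiction (sym v≡u) u≢v
  ... | tri≈ _ u≡v _ | tri< _ v≢u _ = contradiction (sym u≡v) v≢u
  ... | tri≈ _ u≡v _ | tri> _ v≢u _ = contradiction (sym u≡v) v≢u
  ... | tri> _ u≢v _ | tri≈ _ v≡u _ = contradiction (sym v≡u) u≢v
  ... | tri> u≮v _ _ | tri> _ _ u<v = contradiction u<v u≮v

theorem3 : ∀ (G : Graph) (k : ℕ) → HasTreewidth G k →
    ∃ λ (L : QueueLayout G) → QueueLayout.IsLocal L (k + 1)
theorem3 G k ((D , refl) , _) = layout , λ v → begin
  QueueLayout.queuesAt layout v ≤⟨ queuesAt≤∣∣ (bag (top v)) centre∈top ⟩
  ∣ bag (top v) ∣               ≤⟨ ∣bag∣≤1+width (top v) ⟩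
  1 + width                     ≡⟨ +-comm 1 width ⟩
  width + 1                     ∎
  where
  open ≤-Reasoning
  open Graph G
  open TreeDecomposition D
  open Tops D
  open Lower height

  open StarLayout G lower lower-comm (λ u v → Sum.map proj₁ proj₁ (lower-sel u v))

  centre∈top : ∀ {v u} → v ∼ u → lower v u ∈ bag (top v)
  centre∈top {v} {u} v∼u with lower-sel v u
  ... | inj₁ (eq , _)   = subst (_∈ _) (sym eq) (top-∈ v)
  ... | inj₂ (eq , u≤v) = subst (_∈ _) (sym eq) (higher-∈-top (∼-sym v∼u) u≤v)
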